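{- There exists a degree-$6$ oriented graph $D$ with $\mathrm{fas}(D)\ge 25m/72$, where $m$ is the number of arcs of $D$. In particular, $c'_{\le 6}\ge 25/72$ and $c''_{\le 6}=c''_6\ge 75/72$.
   Context: All digraphs are finite. An oriented multigraph is a directed multigraph (parallel arcs allowed) without loops and without directed cycles of length 2; an oriented graph is an oriented multigraph without parallel arcs. Arcs are counted with multiplicity. For an oriented multigraph $D$, $n$ denotes its number of vertices and $m$ its number of arcs. The degree of a vertex is the number of arcs incident with it (the sum of its out-degree and in-degree, counted with multiplicity), $\Delta(D)$ is the maximum degree, and $D$ is degree-$k$ if every vertex has degree exactly $k$. $\mathrm{fas}(D)$ is the minimum number of arcs in a feedback arc set of $D$, i.e. in a set $F$ of arcs such that $D-F$ has no directed cycle. Let $c'_{\le k}$ (respectively $c''_{\le k}$) be the infimum of all reals $c$ such that $\mathrm{fas}(D)\le c\cdot m$ (respectively $\mathrm{fas}(D)\le c\cdot n$) holds for all oriented multigraphs $D$ with $\Delta(D)\le k$. Let $c''_k$ be the infimum of all reals $c$ such that $\mathrm{fas}(D)\le c\cdot n$ holds for all degree-$k$ oriented multigraphs $D$. -}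

module Defs where

open import Data.Nat as ℕ using (ℕ; zero; suc; NonZero)
import Data.Nat.Properties as ℕ
open import Data.Nat.DivMod using (_mod_)
open import Data.Nat.Induction using (<-wellFounded)
open import Data.Integer using (+_)
open import Data.Rational as ℚ using (ℚ; _/_)
import Data.Rational.Properties as ℚ
open import Data.Fin using (Fin; toℕ; fromℕ<)
open import Data.Fin.Properties using (_≟_; any?; all?; toℕ-fromℕ<; injective⇒≤)
open import Data.Fin.Subset using (Subset; _∉_; ∣_∣; ⊤)
open import Data.Fin.Subset.Properties using (_∈?_; ∈⊤; anySubset?)
open import Data.List as List using ()
open import Data.List.Extrema.Nat using (max)
open import Data.Vec as Vec using (Vec; []; _∷_; lookup; count)
open import Data.Product using (∃; ∃-syntax; _×_; _,_; proj₁; proj₂)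
open import Function using (_∘_)
open import Function.Definitions using (Injective)
open import Induction.WellFounded using (Acc; acc)
open import Relation.Binary.PropositionalEquality using (_≡_; _≢_; sym; subst)
open import Relation.Nullary using (¬_; Dec; yes; no)
open import Relation.Nullary.Decidable using (map′; ¬?; _×-dec_; _→-dec_)
open import Relation.Unary using (Pred; Decidable)
open import Level using (0ℓ)

-- Arcs carry labels in Fin m, so parallel arcs are distinct labels with the
-- same endpoints.  As usual, the vertex set is nonempty (otherwise the empty
-- digraph would be degree-k for every k).
record OrientedMultigraph : Set where
  field
    n           : ℕ
    m           : ℕ
    src tgt     : Fin m → Fin n
    nonempty    : NonZero n
    loopless    : ∀ e → src e ≢ tgt e
    no-2-cycles : ∀ e f → ¬ (tgt e ≡ src f × tgt f ≡ src e)

open OrientedMultigraph public using (n; m)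

next : ∀ {l} → Fin (suc l) → Fin (suc l)
next {l} i = suc (toℕ i) mod suc l

module _ (D : OrientedMultigraph) where
  open OrientedMultigraph D using (src; tgt)

  IsOrientedGraph : Set
  IsOrientedGraph = ∀ e f → src e ≡ src f → tgt e ≡ tgt f → e ≡ f

  outDegree inDegree degree : Fin (n D) → ℕ
  outDegree v = count (λ e → src e ≟ v) (Vec.allFin (m D))
  inDegree  v = count (λ e → tgt e ≟ v) (Vec.allFin (m D))
  degree    v = outDegree v ℕ.+ inDegree v

  Δ : ℕ
  Δ = max 0 (List.map degree (List.allFin (n D)))

  IsDegree : ℕ → Set
  IsDegree k = ∀ v → degree v ≡ k

  -- A directed cycle of length suc l, given by its cyclic sequence of arcs;
  -- the vertices it visits are the (pairwise distinct) sources of these arcs.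
  IsDirectedCycle : ∀ {l} → Vec (Fin (m D)) (suc l) → Set
  IsDirectedCycle C =
      (∀ i → tgt (lookup C i) ≡ src (lookup C (next i)))
    × Injective _≡_ _≡_ (src ∘ lookup C)

  IsFeedbackArcSet : Subset (m D) → Set
  IsFeedbackArcSet F =
    ∀ {l} (C : Vec (Fin (m D)) (suc l)) → IsDirectedCycle C →
    ¬ (∀ i → lookup C i ∉ F)

  IsMinimumFeedbackArcSet : Subset (m D) → Set
  IsMinimumFeedbackArcSet F =
    IsFeedbackArcSet F × (∀ G → IsFeedbackArcSet G → ∣ F ∣ ℕ.≤ ∣ G ∣)

anyVec? : ∀ {k l} {P : Pred (Vec (Fin k) l) 0ℓ} → Decidable P → Dec (∃ P)
anyVec? {l = zero}  P? = map′ ([] ,_) (λ { ([] , p) → p }) (P? [])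
anyVec? {l = suc _} P? =
  map′ (λ { (x , xs , p) → x ∷ xs , p }) (λ { (x ∷ xs , p) → x , xs , p })
       (any? λ x → anyVec? λ xs → P? (x ∷ xs))

minimumSubset : ∀ {k} {P : Pred (Subset k) 0ℓ} → Decidable P → ∃ P →
                ∃[ F ] P F × (∀ G → P G → ∣ F ∣ ℕ.≤ ∣ G ∣)
minimumSubset {P = P} P? (F , p) = go F p (<-wellFounded _)
  where
  go : ∀ F → P F → Acc ℕ._<_ ∣ F ∣ → ∃[ F ] P F × (∀ G → P G → ∣ F ∣ ℕ.≤ ∣ G ∣)
  go F p (acc rs) with anySubset? (λ G → P? G ×-dec (∣ G ∣ ℕ.<? ∣ F ∣))
  ... | yes (G , q , G<F) = go G q (rs G<F)
  ... | no ¬smaller       = F , p , λ G q → ℕ.≮⇒≥ λ G<F → ¬smaller (G , q , G<F)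

module _ (D : OrientedMultigraph) where
  open OrientedMultigraph D using (src; tgt)

  isDirectedCycle? : ∀ {l} → Decidable (IsDirectedCycle D {l})
  isDirectedCycle? C =
    all? (λ i → tgt (lookup C i) ≟ src (lookup C (next i)))
    ×-dec
    map′ (λ h {i} {j} → h i j) (λ h i j → h {i} {j})
      (all? λ i → all? λ j → (src (lookup C i) ≟ src (lookup C j)) →-dec (i ≟ j))

  -- Cycles have at most n vertices, so only finitely many need checking.
  isFeedbackArcSet? : Decidable (IsFeedbackArcSet D)
  isFeedbackArcSet? F = map′ to from (¬? (any? λ (i : Fin (n D)) → anyVec? (bad? (toℕ i))))
    where
    Bad : ∀ l → Pred (Vec (Fin (m D)) (suc l)) 0ℓ
    Bad l C = IsDirectedCycle D C × (∀ i → lookup C i ∉ F)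

    bad? : ∀ l → Decidable (Bad l)
    bad? l C = isDirectedCycle? C ×-dec all? (λ i → ¬? (lookup C i ∈? F))

    to : ¬ (∃[ i ] ∃ (Bad (toℕ {n D} i))) → IsFeedbackArcSet D F
    to h {l} C cyc avoids =
      h (fromℕ< l<n , subst (∃ ∘ Bad) (sym (toℕ-fromℕ< l<n)) (C , cyc , avoids))
      where
      l<n : l ℕ.< n D
      l<n = injective⇒≤ (proj₂ cyc)

    from : IsFeedbackArcSet D F → ¬ (∃[ i ] ∃ (Bad (toℕ {n D} i)))
    from h (_ , C , cyc , avoids) = h C cyc avoids

  abstract
    minimumFeedbackArcSet : ∃ (IsMinimumFeedbackArcSet D)
    minimumFeedbackArcSet =
      minimumSubset isFeedbackArcSet?
        (⊤ , λ C _ avoids → avoids Fin.zero ∈⊤)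

  fas : ℕ
  fas = ∣ proj₁ minimumFeedbackArcSet ∣

-- A real number x is represented by its upper cut { q ∈ ℚ ∣ x < q }.
-- Classically this is the usual Dedekind real line.  Without a lower cut,
-- nonempty sets that are bounded below can have infima constructively.
record ℝ : Set₁ where
  field
    Upper   : ℚ → Set
    inhab   : ∃ Upper
    bounded : ∃[ b ] (∀ {q} → Upper q → b ℚ.≤ q)
    upward  : ∀ {p q} → p ℚ.< q → Upper p → Upper q
    rounded : ∀ {q} → Upper q → ∃[ p ] (p ℚ.< q × Upper p)

open ℝ

infix  4 _≤ᴿ_ _≈ᴿ_
infixl 7 _·_

_≤ᴿ_ : ℝ → ℝ → Set
x ≤ᴿ y = ∀ {q} → Upper y q → Upper x q

_≈ᴿ_ : ℝ → ℝ → Set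
x ≈ᴿ y = x ≤ᴿ y × y ≤ᴿ x

fromℕ : ℕ → ℚ
fromℕ k = + k / 1

fromℚ : ℚ → ℝ
fromℚ p .Upper q  = p ℚ.< q
fromℚ p .inhab    = p ℚ.+ ℚ.1ℚ , p<p+1 p
  where
  p<p+1 : ∀ p → p ℚ.< p ℚ.+ ℚ.1ℚ
  p<p+1 p = subst (ℚ._< p ℚ.+ ℚ.1ℚ) (ℚ.+-identityʳ p) (ℚ.+-monoʳ-< p (ℚ.positive⁻¹ ℚ.1ℚ))
fromℚ p .bounded  = p , ℚ.<⇒≤
fromℚ p .upward r<q p<r = ℚ.<-trans p<r r<q
fromℚ p .rounded p<q with r , p<r , r<q ← ℚ.<-dense p<q = r , r<q , p<r

-- The product k x of a natural number and a real: k x < q iff k p < q for some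
-- rational p > x.
_·_ : ℕ → ℝ → ℝ
(k · x) .Upper q = ∃[ p ] (Upper x p × fromℕ k ℚ.* p ℚ.< q)
(k · x) .inhab with p , xp ← inhab x | q , kp<q ← inhab (fromℚ (fromℕ k ℚ.* proj₁ (inhab x))) =
  q , p , xp , kp<q
(k · x) .bounded with b , b≤ ← bounded x =
  fromℕ k ℚ.* b , λ { (p , xp , kp<q) →
    ℚ.≤-trans (ℚ.*-monoˡ-≤-nonNeg (fromℕ k) {{ℚ.normalize-nonNeg k 1}} (b≤ xp)) (ℚ.<⇒≤ kp<q) }
(k · x) .upward r<q (p , xp , kp<r) = p , xp , ℚ.<-trans kp<r r<q
(k · x) .rounded (p , xp , kp<q) with r , kp<r , r<q ← ℚ.<-dense kp<q = r , r<q , p , xp , kp<r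

IsInfimum : Pred ℝ 0ℓ → ℝ → Set₁
IsInfimum S x =
    (∀ c → S c → x ≤ᴿ c)
  × (∀ y → (∀ c → S c → y ≤ᴿ c) → y ≤ᴿ x)

-- The constants c′_{≤k}, c″_{≤k} and c″_k are the infima of these sets.

ArcBounds≤ : ℕ → Pred ℝ 0ℓ
ArcBounds≤ k c = ∀ D → Δ D ℕ.≤ k → fromℚ (fromℕ (fas D)) ≤ᴿ m D · c

VertexBounds≤ : ℕ → Pred ℝ 0ℓ
VertexBounds≤ k c = ∀ D → Δ D ℕ.≤ k → fromℚ (fromℕ (fas D)) ≤ᴿ n D · c

VertexBounds : ℕ → Pred ℝ 0ℓ
VertexBounds k c = ∀ D → IsDegree D k → fromℚ (fromℕ (fas D)) ≤ᴿ n D · c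

{-# OPTIONS --safe #-}
module Submission where

-- A core H on 8 vertices with 20 arcs has 12 directed triangles and a directed
-- 4-cycle which together cover every arc exactly twice, so 2 fas(H) ≥ 13 and
-- fas(H) ≥ 7 > 20/3.  Four vertices of H have degree 4, the others degree 6.
-- Joining the three copies of each degree-4 vertex in three copies of H by a
-- directed triangle gives a degree-6 oriented graph with 24 vertices and 72 arcs
-- in which every feedback arc set has at least 3 · 7 + 4 = 25 arcs.
--
-- For c″_{≤k} = c″_k: take two copies of D and join the copies of each vertex v by
-- k − deg(v) parallel arcs from the first to the second copy.  The result has
-- degree k, twice as many vertices, and at least twice the feedback arc number.

open import Defs
open import Data.Nat using (_*_; _≤_)
open import Data.Integer using (+_)
open import Data.Rational using (_/_)
open import Data.Product using (_×_; ∃-syntax)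

open import Data.Bool using (true; false; if_then_else_)
open import Data.Fin using (Fin; zero; suc; combine; inject≤; _↑ˡ_; _↑ʳ_; splitAt)
open import Data.Fin.Patterns
open import Data.Fin.Properties
  using (all?; ¬∀⟶∃¬; suc-injective; ↑ˡ-injective; ↑ʳ-injective;
         splitAt-↑ˡ; splitAt-↑ʳ; splitAt⁻¹-↑ˡ; splitAt⁻¹-↑ʳ)
  renaming (_≟_ to _≟ᶠ_)
open import Data.Fin.Subset using (Subset; inside; outside; _∈_; _∉_; ∣_∣)
open import Data.Fin.Subset.Properties using (_∈?_; ∣p∣≤n)
import Data.Integer as ℤ
import Data.Integer.Properties as ℤ
open import Data.List as List using (List; []; _∷_; length; upTo)
import Data.List.Extrema
open import Data.List.Membership.Propositional.Properties using (∈-map⁺; ∈-allFin)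
open import Data.List.Relation.Unary.All as All using (All; []; _∷_)
import Data.List.Relation.Unary.All.Properties as All
open import Data.Nat as ℕ using (ℕ; zero; suc; _+_; _∸_; _<_; z≤n; NonZero)
open import Data.Nat.DivMod using (_mod_)
open import Data.Nat.Properties as ℕ hiding (suc-injective)
open import Data.Nat.Solver using (module +-*-Solver)
open import Data.Product using (_,_; proj₁; proj₂)
open import Data.Rational as ℚ using (ℚ)
import Data.Rational.Properties as ℚ
import Data.Rational.Unnormalised as ℚᵘ
import Data.Rational.Unnormalised.Properties as ℚᵘ
open import Data.Sum using (inj₁; inj₂)
open import Data.Vec as Vec using (Vec; []; _∷_; lookup; _++_; count)
open import Data.Vec.Properties as Vec
  using (lookup-map; lookup-++ˡ; lookup-++ʳ; []=⇒lookup; lookup⇒[]=)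
open import Function using (_∘_)
open import Function.Definitions using (Injective)
open import Level using (0ℓ)
open import Relation.Binary.PropositionalEquality
import Relation.Binary.Reasoning.Setoid
open import Relation.Nullary using (¬_; Dec; yes; no; does; contradiction)
open import Relation.Nullary.Decidable using (from-yes; ¬?; _×-dec_; _→-dec_; decidable-stable)
open import Relation.Unary using (Pred; Decidable)

open import Algebra.Properties.CommutativeMonoid.Sum +-0-commutativeMonoid
  using (sum; ∑-distrib-+; sum-cong-≗; sum-replicate-zero)
open Data.List.Extrema ≤-totalOrder using (xs≤max; max≤v⁺)
open ℝ

private
  variable
    A B : Set
    k l : ℕ

-- Weights of arc sets and packings of directed cycles.

weight : Subset k → Vec ℕ k → ℕ
weight []            []      = 0
weight (inside  ∷ F) (x ∷ μ) = x + weight F μ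
weight (outside ∷ F) (x ∷ μ) = weight F μ

weight-ones : (F : Subset k) → weight F (Vec.replicate k 1) ≡ ∣ F ∣
weight-ones []            = refl
weight-ones (inside  ∷ F) = cong suc (weight-ones F)
weight-ones (outside ∷ F) = weight-ones F

weight-+ : ∀ (F : Subset k) μ ν → weight F (Vec.zipWith _+_ μ ν) ≡ weight F μ + weight F ν
weight-+ []            []      []      = refl
weight-+ (inside  ∷ F) (x ∷ μ) (y ∷ ν) rewrite weight-+ F μ ν =
  solve 4 (λ a b c d → (a :+ b) :+ (c :+ d) := (a :+ c) :+ (b :+ d)) refl x y (weight F μ) (weight F ν)
  where open +-*-Solver
weight-+ (outside ∷ F) (x ∷ μ) (y ∷ ν) = weight-+ F μ ν

weight-* : ∀ (F : Subset k) a μ → weight F (Vec.map (a *_) μ) ≡ a * weight F μ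
weight-* []            a []      = sym (*-zeroʳ a)
weight-* (inside  ∷ F) a (x ∷ μ) rewrite weight-* F a μ = sym (*-distribˡ-+ a x (weight F μ))
weight-* (outside ∷ F) a (x ∷ μ) = weight-* F a μ

bump : Fin k → Vec ℕ k → Vec ℕ k
bump e μ = Vec.updateAt μ e suc

weight-bump : ∀ (F : Subset k) e μ → weight F μ ≤ weight F (bump e μ)
weight-bump (inside  ∷ F) zero    (x ∷ μ) = n≤1+n _
weight-bump (outside ∷ F) zero    (x ∷ μ) = ≤-refl
weight-bump (inside  ∷ F) (suc e) (x ∷ μ) = +-monoʳ-≤ x (weight-bump F e μ)
weight-bump (outside ∷ F) (suc e) (x ∷ μ) = weight-bump F e μ

weight-bump-∈ : ∀ (F : Subset k) {e} μ → e ∈ F → weight F μ < weight F (bump e μ)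
weight-bump-∈ (inside  ∷ F) {zero}  (x ∷ μ) _  = ≤-refl
weight-bump-∈ (inside  ∷ F) {suc e} (x ∷ μ) (Vec.there e∈F) = +-monoʳ-< x (weight-bump-∈ F μ e∈F)
weight-bump-∈ (outside ∷ F) {suc e} (x ∷ μ) (Vec.there e∈F) = weight-bump-∈ F μ e∈F

bumpAll : Vec (Fin k) l → Vec ℕ k → Vec ℕ k
bumpAll C μ = Vec.foldr _ bump μ C

weight-bumpAll : ∀ (F : Subset k) (C : Vec (Fin k) l) μ → weight F μ ≤ weight F (bumpAll C μ)
weight-bumpAll F []      μ = ≤-refl
weight-bumpAll F (e ∷ C) μ = ≤-trans (weight-bumpAll F C μ) (weight-bump F e _)

weight-bumpAll-∈ : ∀ (F : Subset k) (C : Vec (Fin k) l) μ i → lookup C i ∈ F →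
                   weight F μ < weight F (bumpAll C μ)
weight-bumpAll-∈ F (e ∷ C) μ zero    e∈F =
  ≤-<-trans (weight-bumpAll F C μ) (weight-bump-∈ F _ e∈F)
weight-bumpAll-∈ F (e ∷ C) μ (suc i) p   =
  <-≤-trans (weight-bumpAll-∈ F C μ i p) (weight-bump F e _)

ArcCycle : ℕ → Set
ArcCycle k = ∃[ l ] Vec (Fin k) (suc l)

multiplicity : List (ArcCycle k) → Vec ℕ k
multiplicity = List.foldr (bumpAll ∘ proj₂) (Vec.replicate _ 0)

module _ (D : OrientedMultigraph) {F : Subset (m D)} (FAS : IsFeedbackArcSet D F) where

  -- Being a feedback arc set only refutes that `C` avoids `F`. Membership is decidable and `C` has
  -- finitely many arcs, so the refutation yields an actual arc.
  cycle-hit : (C : Vec (Fin (m D)) (suc l)) → IsDirectedCycle D C → ∃[ i ] lookup C i ∈ F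
  cycle-hit C cyc
    with i , h ← ¬∀⟶∃¬ _ _ (λ i → ¬? (lookup C i ∈? F)) (FAS C cyc) =
    i , decidable-stable (_ ∈? F) h

  -- Double counting: each further cycle contains an arc of `F`, so adding its arcs to the
  -- multiplicities raises the weight of `F` by at least one.
  packing-bound : (Cs : List (ArcCycle (m D))) → All (IsDirectedCycle D ∘ proj₂) Cs →
                  length Cs ≤ weight F (multiplicity Cs)
  packing-bound []       []           = z≤n
  packing-bound (C ∷ Cs) (cyc ∷ cycs) with i , p ← cycle-hit (proj₂ C) cyc =
    ≤-<-trans (packing-bound Cs cycs) (weight-bumpAll-∈ F (proj₂ C) (multiplicity Cs) i p)

-- The degree-6 oriented graph on 24 vertices.

core : Vec (Fin 8 × Fin 8) 20
core =
  (0F , 1F) ∷ (0F , 4F) ∷ (1F , 6F) ∷ (1F , 7F) ∷ (2F , 4F) ∷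
  (2F , 6F) ∷ (3F , 4F) ∷ (3F , 7F) ∷ (4F , 5F) ∷ (4F , 6F) ∷
  (4F , 7F) ∷ (5F , 1F) ∷ (5F , 2F) ∷ (5F , 3F) ∷ (6F , 0F) ∷
  (6F , 3F) ∷ (6F , 5F) ∷ (7F , 0F) ∷ (7F , 2F) ∷ (7F , 5F) ∷ []

coreCopy : Fin 3 → Vec (Fin 24 × Fin 24) 20
coreCopy c = Vec.map (λ (u , v) → combine c u , combine c v) core

-- The core vertices of degree 4 are 0, …, 3.
link : Fin 4 → Vec (Fin 24 × Fin 24) 3
link v = Vec.map (λ c → combine c w , combine (next c) w) (Vec.allFin 3)
  where
  w : Fin 8
  w = inject≤ v (m≤m+n 4 4)

arcs₂₄ : Vec (Fin 24 × Fin 24) 72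
arcs₂₄ = Vec.concat (Vec.map coreCopy (Vec.allFin 3)) ++ Vec.concat (Vec.map link (Vec.allFin 4))

src₂₄ tgt₂₄ : Fin 72 → Fin 24
src₂₄ = proj₁ ∘ lookup arcs₂₄
tgt₂₄ = proj₂ ∘ lookup arcs₂₄

D₂₄ : OrientedMultigraph
D₂₄ = record
  { n = 24
  ; m = 72
  ; src = src₂₄
  ; tgt = tgt₂₄
  ; nonempty = _
  ; loopless = from-yes (all? λ e → ¬? (src₂₄ e ≟ᶠ tgt₂₄ e))
  ; no-2-cycles = from-yes (all? λ e → all? λ f →
      ¬? ((tgt₂₄ e ≟ᶠ src₂₄ f) ×-dec (tgt₂₄ f ≟ᶠ src₂₄ e)))
  }

abstract
  D₂₄-simple : IsOrientedGraph D₂₄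
  D₂₄-simple = from-yes (all? λ e → all? λ f →
    (src₂₄ e ≟ᶠ src₂₄ f) →-dec ((tgt₂₄ e ≟ᶠ tgt₂₄ f) →-dec (e ≟ᶠ f)))

  D₂₄-regular : IsDegree D₂₄ 6
  D₂₄-regular = from-yes (all? λ v → degree D₂₄ v ℕ.≟ 6)

-- For b < 3, arc b i is the i-th arc of core copy b; arc 3 (3 v + c) is the c-th arc
-- of the triangle at the core vertex v.
arc : ℕ → ℕ → Fin 72
arc b i = (20 * b + i) mod 72

-- Every core arc lies on exactly two of these cycles.
coreCycles : List (∃[ l ] Vec ℕ (suc l))
coreCycles =
  (2 , 0 ∷ 2 ∷ 14 ∷ []) ∷ (2 , 0 ∷ 3 ∷ 17 ∷ []) ∷
  (2 , 1 ∷ 9 ∷ 14 ∷ []) ∷ (2 , 1 ∷ 10 ∷ 17 ∷ []) ∷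
  (2 , 2 ∷ 16 ∷ 11 ∷ []) ∷ (2 , 3 ∷ 19 ∷ 11 ∷ []) ∷
  (2 , 8 ∷ 12 ∷ 4 ∷ []) ∷ (2 , 8 ∷ 13 ∷ 6 ∷ []) ∷
  (2 , 9 ∷ 15 ∷ 6 ∷ []) ∷ (2 , 10 ∷ 18 ∷ 4 ∷ []) ∷
  (2 , 12 ∷ 5 ∷ 16 ∷ []) ∷ (2 , 13 ∷ 7 ∷ 19 ∷ []) ∷
  (3 , 15 ∷ 7 ∷ 18 ∷ 5 ∷ []) ∷ []

linkCycles : List (∃[ l ] Vec ℕ (suc l))
linkCycles = List.map (λ v → 2 , Vec.map (λ i → 3 * v + i) (0 ∷ 1 ∷ 2 ∷ [])) (upTo 4)

embed : ℕ → List (∃[ l ] Vec ℕ (suc l)) → List (ArcCycle 72)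
embed b = List.map (λ (l , C) → l , Vec.map (arc b) C)

-- With `s = 20` for a core copy and `s = 12` for the links, this is the 0-1 indicator vector of the
-- whole block.
block : ℕ → ℕ → Vec ℕ 72
block b s = List.foldr bump (Vec.replicate _ 0) (List.map (arc b) (upTo s))

cycles? : (Cs : List (ArcCycle 72)) → Dec (All (IsDirectedCycle D₂₄ ∘ proj₂) Cs)
cycles? = All.all? (isDirectedCycle? D₂₄ ∘ proj₂)

module _ {F : Subset 72} (FAS : IsFeedbackArcSet D₂₄ F) where
  -- The two hypotheses, that the 13 cycles are directed and that they cover the block exactly
  -- twice, are closed facts for each copy; they are settled by evaluation where `b` is 0, 1 and 2.
  core-bound : ∀ b → All (IsDirectedCycle D₂₄ ∘ proj₂) (embed b coreCycles) →
               multiplicity (embed b coreCycles) ≡ Vec.map (2 *_) (block b 20) →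
               7 ≤ weight F (block b 20)
  -- Rounding 13/2 up to 7: the inequality `13 ≤ 2 * w` is `2 * 6 < 2 * w`, and strict cancellation
  -- leaves `6 < w`.
  core-bound b cycs eq = *-cancelˡ-< 2 6 _
    (subst (13 ≤_) (trans (cong (weight F) eq) (weight-* F 2 (block b 20)))
      (packing-bound D₂₄ FAS (embed b coreCycles) cycs))

  -- The four link triangles are arc-disjoint and exhaust their block, so their multiplicity vector
  -- evaluates to `block 3 12`.
  link-bound : 4 ≤ weight F (block 3 12)
  link-bound = packing-bound D₂₄ FAS (embed 3 linkCycles) (from-yes (cycles? (embed 3 linkCycles)))

  D₂₄-bound : 25 ≤ ∣ F ∣
  D₂₄-bound = begin
    7 + (7 + (7 + 4))
      ≤⟨ +-mono-≤ (core-bound 0 (from-yes (cycles? (embed 0 coreCycles))) refl)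
        (+-mono-≤ (core-bound 1 (from-yes (cycles? (embed 1 coreCycles))) refl)
        (+-mono-≤ (core-bound 2 (from-yes (cycles? (embed 2 coreCycles))) refl) link-bound)) ⟩
    w 0 20 + (w 1 20 + (w 2 20 + w 3 12))
      ≡⟨ cong (w 0 20 ℕ.+_) (cong (w 1 20 ℕ.+_) (weight-+ F _ _)) ⟨
    w 0 20 + (w 1 20 + weight F (block 2 20 ⊕ block 3 12))
      ≡⟨ cong (w 0 20 ℕ.+_) (weight-+ F _ _) ⟨
    w 0 20 + weight F (block 1 20 ⊕ (block 2 20 ⊕ block 3 12))
      ≡⟨ weight-+ F _ _ ⟨
    -- The four blocks partition the 72 arcs, so this sum of indicators evaluates to the all-ones
    -- vector.
    weight F (block 0 20 ⊕ (block 1 20 ⊕ (block 2 20 ⊕ block 3 12)))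
      ≡⟨ weight-ones F ⟩
    ∣ F ∣ ∎
    where
    open ≤-Reasoning
    w : ℕ → ℕ → ℕ
    w b s = weight F (block b s)
    _⊕_ : Vec ℕ 72 → Vec ℕ 72 → Vec ℕ 72
    _⊕_ = Vec.zipWith _+_

-- Counting entries of vectors.

count-++ : {P : Pred A 0ℓ} (P? : Decidable P) (xs : Vec A k) (ys : Vec A l) →
           count P? (xs ++ ys) ≡ count P? xs + count P? ys
count-++ P? []       ys = refl
count-++ P? (x ∷ xs) ys with does (P? x)
... | true  = cong suc (count-++ P? xs ys)
... | false = count-++ P? xs ys

count-map : {P : Pred B 0ℓ} (P? : Decidable P) (f : A → B) (xs : Vec A k) →
            count P? (Vec.map f xs) ≡ count (P? ∘ f) xs
count-map P? f []       = refl
count-map P? f (x ∷ xs) with does (P? (f x))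
... | true  = cong suc (count-map P? f xs)
... | false = count-map P? f xs

count-⇔ : {P Q : Pred A 0ℓ} (P? : Decidable P) (Q? : Decidable Q) →
          (∀ x → P x → Q x) → (∀ x → Q x → P x) →
          (xs : Vec A k) → count P? xs ≡ count Q? xs
count-⇔ P? Q? to from []       = refl
count-⇔ P? Q? to from (x ∷ xs) with P? x | Q? x
... | yes p | yes q = cong suc (count-⇔ P? Q? to from xs)
... | no ¬p | no ¬q = count-⇔ P? Q? to from xs
... | yes p | no ¬q = contradiction (to x p) ¬q
... | no ¬p | yes q = contradiction (from x q) ¬p

count-none : {P : Pred A 0ℓ} (P? : Decidable P) → (∀ x → ¬ P x) →
             (xs : Vec A k) → count P? xs ≡ 0
count-none P? ¬P []       = refl
count-none P? ¬P (x ∷ xs) with P? x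
... | yes p = contradiction p (¬P x)
... | no _  = count-none P? ¬P xs

count-replicate-yes : {P : Pred A 0ℓ} (P? : Decidable P) {x : A} → P x → ∀ k →
                      count P? (Vec.replicate k x) ≡ k
count-replicate-yes P? p zero    = refl
count-replicate-yes P? {x} p (suc k) with P? x
... | yes _ = cong suc (count-replicate-yes P? p k)
... | no ¬p = contradiction p ¬p

count-replicate-no : {P : Pred A 0ℓ} (P? : Decidable P) {x : A} → ¬ P x → ∀ k →
                     count P? (Vec.replicate k x) ≡ 0
count-replicate-no P? ¬p zero    = refl
count-replicate-no P? {x} ¬p (suc k) with P? x
... | yes p = contradiction p ¬p
... | no _  = count-replicate-no P? ¬p k

count-lookup : {P : Pred A 0ℓ} (P? : Decidable P) (xs : Vec A k) →
               count (P? ∘ lookup xs) (Vec.allFin k) ≡ count P? xs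
count-lookup P? xs =
  trans (sym (count-map P? (lookup xs) (Vec.allFin _))) (cong (count P?) (Vec.map-lookup-allFin xs))

δ : Fin k → Fin k → ℕ
δ w v = if does (w ≟ᶠ v) then 1 else 0

sum-δ : (w : Fin k) → sum (δ w) ≡ 1
sum-δ {suc k} zero    = cong suc (sum-replicate-zero k)
sum-δ {suc k} (suc w) = sum-δ w

-- Every entry lies in exactly one fibre of `f`. For `f = src` this says that the out-degrees add up
-- to the number of arcs.
sum-count : (f : A → Fin k) (xs : Vec A l) → sum (λ v → count (λ x → f x ≟ᶠ v) xs) ≡ l
sum-count {k = k} f [] = sum-replicate-zero k
sum-count {k = k} {l = suc l} f (x ∷ xs) = begin
  sum (λ v → count (λ x → f x ≟ᶠ v) (x ∷ xs))               ≡⟨ sum-cong-≗ {k} step ⟩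
  sum (λ v → δ (f x) v + count (λ x → f x ≟ᶠ v) xs)         ≡⟨ ∑-distrib-+ (δ (f x)) _ ⟩
  sum (δ (f x)) + sum (λ v → count (λ x → f x ≟ᶠ v) xs)     ≡⟨ cong₂ _+_ (sum-δ (f x)) (sum-count f xs) ⟩
  suc l                                                     ∎
  where
  open ≡-Reasoning
  step : ∀ v → count (λ x → f x ≟ᶠ v) (x ∷ xs) ≡ δ (f x) v + count (λ x → f x ≟ᶠ v) xs
  step v with does (f x ≟ᶠ v)
  ... | true  = refl
  ... | false = refl

sum-≤ : ∀ c (f : Fin k → ℕ) → (∀ v → f v ≤ c) → sum f ≤ k * c
sum-≤ {zero}  c f f≤c = z≤n
sum-≤ {suc k} c f f≤c = +-mono-≤ (f≤c zero) (sum-≤ c (f ∘ suc) (f≤c ∘ suc))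

-- Elementary bounds on degrees and on `fas`.

module _ (D : OrientedMultigraph) where

  degree≤Δ : ∀ v → degree D v ≤ Δ D
  degree≤Δ v = All.lookup (xs≤max 0 (List.map (degree D) (List.allFin (n D)))) (∈-map⁺ (degree D) (∈-allFin v))

  regular⇒Δ≤ : IsDegree D k → Δ D ≤ k
  regular⇒Δ≤ reg = max≤v⁺ {xs = List.map (degree D) (List.allFin (n D))} z≤n
    (All.map⁺ (All.tabulate λ {v} _ → ≤-reflexive (reg v)))

  -- The out-degrees add up to `m D`, and each is at most `Δ D`. This crude bound suffices to make
  -- the vertex ratio bounded.
  m≤n*Δ : m D ≤ n D * Δ D
  m≤n*Δ = subst (_≤ n D * Δ D) (sum-count (OrientedMultigraph.src D) (Vec.allFin (m D)))
    (sum-≤ (Δ D) (outDegree D) λ v → ≤-trans (m≤m+n _ (inDegree D v)) (degree≤Δ v))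

  minimum-isFeedbackArcSet : IsFeedbackArcSet D (proj₁ (minimumFeedbackArcSet D))
  minimum-isFeedbackArcSet = proj₁ (proj₂ (minimumFeedbackArcSet D))

  fas≤∣FAS∣ : ∀ F → IsFeedbackArcSet D F → fas D ≤ ∣ F ∣
  fas≤∣FAS∣ = proj₂ (proj₂ (minimumFeedbackArcSet D))

  fas≤m : fas D ≤ m D
  fas≤m = ∣p∣≤n (proj₁ (minimumFeedbackArcSet D))

-- Doubling an oriented multigraph into a regular one.

spread : (d : Fin k → ℕ) → Vec (Fin k) (sum d)
spread {zero}  d = []
spread {suc k} d = Vec.replicate (d zero) zero ++ Vec.map suc (spread (d ∘ suc))

count-spread : ∀ (d : Fin k → ℕ) w → count (_≟ᶠ w) (spread d) ≡ d w
count-spread {suc k} d w =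
  trans (count-++ (_≟ᶠ w) (Vec.replicate (d zero) zero) _)
    (trans (cong (count (_≟ᶠ w) (Vec.replicate (d zero) zero) ℕ.+_) (count-map (_≟ᶠ w) suc (spread (d ∘ suc)))) (go w))
  where
  go : ∀ w → count (_≟ᶠ w) (Vec.replicate (d zero) zero) + count (λ v → suc v ≟ᶠ w) (spread (d ∘ suc)) ≡ d w
  go zero = trans (cong₂ _+_ (count-replicate-yes (_≟ᶠ zero) refl (d zero))
                             (count-none (λ v → suc v ≟ᶠ zero) (λ _ ()) (spread (d ∘ suc))))
                  (+-identityʳ (d zero))
  go (suc w) = cong₂ _+_ (count-replicate-no (_≟ᶠ suc w) (λ ()) (d zero))
    (trans (count-⇔ (λ v → suc v ≟ᶠ suc w) (_≟ᶠ w) (λ _ → suc-injective) (λ _ → cong suc) (spread (d ∘ suc)))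
           (count-spread (d ∘ suc) w))

-- Incidences are preserved and injectivity of `ψ` keeps the sources distinct, so directed cycles go
-- to directed cycles. A cycle of `D` avoiding `F` would thus give a cycle of `D′` avoiding `F′`.
FAS-pullback : ∀ D D′ (φ : Fin (m D) → Fin (m D′)) (ψ : Fin (n D) → Fin (n D′)) →
               Injective _≡_ _≡_ ψ →
               (∀ e → OrientedMultigraph.src D′ (φ e) ≡ ψ (OrientedMultigraph.src D e)) →
               (∀ e → OrientedMultigraph.tgt D′ (φ e) ≡ ψ (OrientedMultigraph.tgt D e)) →
               ∀ {F F′} → (∀ {e} → φ e ∈ F′ → e ∈ F) →
               IsFeedbackArcSet D′ F′ → IsFeedbackArcSet D F
FAS-pullback D D′ φ ψ ψ-inj φ-src φ-tgt {F} {F′} F′⇒F FAS C (chain , src-inj) avoids =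
  FAS (Vec.map φ C) (chain′ , src-inj′) avoids′
  where
  open OrientedMultigraph
  at : ∀ i → lookup (Vec.map φ C) i ≡ φ (lookup C i)
  at i = lookup-map i φ C
  src-at : ∀ i → src D′ (lookup (Vec.map φ C) i) ≡ ψ (src D (lookup C i))
  src-at i = trans (cong (src D′) (at i)) (φ-src _)
  chain′ : ∀ i → tgt D′ (lookup (Vec.map φ C) i) ≡ src D′ (lookup (Vec.map φ C) (next i))
  chain′ i = trans (cong (tgt D′) (at i)) (trans (φ-tgt _) (trans (cong ψ (chain i)) (sym (src-at (next i)))))
  src-inj′ : Injective _≡_ _≡_ (src D′ ∘ lookup (Vec.map φ C))
  src-inj′ {i} {j} eq = src-inj (ψ-inj (trans (sym (src-at i)) (trans eq (src-at j))))
  avoids′ : ∀ i → lookup (Vec.map φ C) i ∉ F′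
  avoids′ i p = avoids i (F′⇒F (subst (_∈ F′) (at i) p))

+-nonZero : NonZero k → NonZero (k + l)
+-nonZero {suc k} _ = _

↑ˡ≢↑ʳ : ∀ (i : Fin k) (j : Fin l) → i ↑ˡ l ≢ k ↑ʳ j
↑ˡ≢↑ʳ {k} {l} i j eq with () ← trans (sym (splitAt-↑ˡ k i l)) (trans (cong (splitAt k) eq) (splitAt-↑ʳ k l j))

module Doubling (D : OrientedMultigraph) (k : ℕ) (degree≤k : ∀ v → degree D v ≤ k) where
  open OrientedMultigraph D using (src; tgt; nonempty; loopless; no-2-cycles)

  -- The value `across v` stands for all the parallel arcs joining the two copies of `v`; they are
  -- told apart by their positions in `arcs`, where `spread` repeats them.
  data Arc : Set where
    left right : Fin (m D) → Arc
    across     : Fin (n D) → Arc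

  L R : Fin (n D) → Fin (n D + n D)
  L v = v ↑ˡ n D
  R v = n D ↑ʳ v

  L-injective : ∀ {u v} → L u ≡ L v → u ≡ v
  L-injective = ↑ˡ-injective (n D) _ _

  R-injective : ∀ {u v} → R u ≡ R v → u ≡ v
  R-injective = ↑ʳ-injective (n D) _ _

  L≢R : ∀ {u v} → L u ≢ R v
  L≢R = ↑ˡ≢↑ʳ _ _

  source target : Arc → Fin (n D + n D)
  source (left e)   = L (src e)
  source (right e)  = R (src e)
  source (across v) = L v
  target (left e)   = L (tgt e)
  target (right e)  = R (tgt e)
  target (across v) = R v

  deficiency : Fin (n D) → ℕ
  deficiency v = k ∸ degree D v

  arcs : Vec Arc (m D + (m D + sum deficiency))
  arcs = Vec.map left (Vec.allFin (m D)) ++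
    (Vec.map right (Vec.allFin (m D)) ++ Vec.map across (spread deficiency))

  source≢target : ∀ a → source a ≢ target a
  source≢target (left e)   = loopless e ∘ L-injective
  source≢target (right e)  = loopless e ∘ R-injective
  source≢target (across v) = L≢R

  -- All `across` arcs lead from the left copy to the right one and none returns, so a 2-cycle would
  -- lie inside one copy and come from a 2-cycle of `D`.
  no-digon : ∀ a b → target a ≡ source b → target b ≢ source a
  no-digon (left e)   (left f)   p q = no-2-cycles e f (L-injective p , L-injective q)
  no-digon (left e)   (right f)  p q = L≢R p
  no-digon (left e)   (across v) p q = L≢R (sym q)
  no-digon (right e)  (left f)   p q = L≢R q
  no-digon (right e)  (right f)  p q = no-2-cycles e f (R-injective p , R-injective q)
  no-digon (right e)  (across v) p q = L≢R (sym p)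
  no-digon (across v) (left f)   p q = L≢R (sym p)
  no-digon (across v) (right f)  p q = L≢R (sym q)
  no-digon (across v) (across w) p q = L≢R (sym p)

  double : OrientedMultigraph
  double = record
    { n           = n D + n D
    ; m           = m D + (m D + sum deficiency)
    ; src         = source ∘ lookup arcs
    ; tgt         = target ∘ lookup arcs
    ; nonempty    = +-nonZero nonempty
    ; loopless    = λ e → source≢target (lookup arcs e)
    ; no-2-cycles = λ e f (p , q) → no-digon (lookup arcs e) (lookup arcs f) p q
    }

  -- Splits a degree of the double into contributions of the left copy, the right copy and the arcs
  -- between them.
  count-arcs : {P : Pred Arc 0ℓ} (P? : Decidable P) →
    count (P? ∘ lookup arcs) (Vec.allFin _) ≡
    count (P? ∘ left) (Vec.allFin (m D)) +
      (count (P? ∘ right) (Vec.allFin (m D)) + count (P? ∘ across) (spread deficiency))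
  count-arcs P? =
    trans (count-lookup P? arcs)
      (trans (count-++ P? (Vec.map left (Vec.allFin (m D))) _)
        (cong₂ _+_ (count-map P? left (Vec.allFin (m D)))
          (trans (count-++ P? (Vec.map right (Vec.allFin (m D))) _)
            (cong₂ _+_ (count-map P? right (Vec.allFin (m D))) (count-map P? across (spread deficiency))))))

  -- The arcs between the copies leave `L v`, so the deficiency goes to the out-degree here and to
  -- the in-degree at `R v`. The zeros come from segments without an arc at the vertex in that
  -- direction.
  degree-L : ∀ v → degree double (L v) ≡ degree D v + deficiency v
  degree-L v = trans (cong₂ _+_ out in′)
    (solve 3 (λ a b c → (a :+ (con 0 :+ c)) :+ (b :+ (con 0 :+ con 0)) := a :+ b :+ c) refl
      (outDegree D v) (inDegree D v) (deficiency v))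
    where
    open +-*-Solver
    out : outDegree double (L v) ≡ outDegree D v + (0 + deficiency v)
    out = trans (count-arcs (λ a → source a ≟ᶠ L v)) (cong₂ _+_
      (count-⇔ _ _ (λ _ → L-injective) (λ _ → cong L) (Vec.allFin (m D)))
      (cong₂ _+_ (count-none _ (λ _ → L≢R ∘ sym) (Vec.allFin (m D)))
        (trans (count-⇔ _ _ (λ _ → L-injective) (λ _ → cong L) (spread deficiency)) (count-spread deficiency v))))
    in′ : inDegree double (L v) ≡ inDegree D v + (0 + 0)
    in′ = trans (count-arcs (λ a → target a ≟ᶠ L v)) (cong₂ _+_
      (count-⇔ _ _ (λ _ → L-injective) (λ _ → cong L) (Vec.allFin (m D)))
      (cong₂ _+_ (count-none _ (λ _ → L≢R ∘ sym) (Vec.allFin (m D)))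
        (count-none _ (λ _ → L≢R ∘ sym) (spread deficiency))))

  degree-R : ∀ v → degree double (R v) ≡ degree D v + deficiency v
  degree-R v = trans (cong₂ _+_ out in′)
    (solve 3 (λ a b c → (con 0 :+ (a :+ con 0)) :+ (con 0 :+ (b :+ c)) := a :+ b :+ c) refl
      (outDegree D v) (inDegree D v) (deficiency v))
    where
    open +-*-Solver
    out : outDegree double (R v) ≡ 0 + (outDegree D v + 0)
    out = trans (count-arcs (λ a → source a ≟ᶠ R v)) (cong₂ _+_
      (count-none _ (λ _ → L≢R) (Vec.allFin (m D)))
      (cong₂ _+_ (count-⇔ _ _ (λ _ → R-injective) (λ _ → cong R) (Vec.allFin (m D)))
        (count-none _ (λ _ → L≢R) (spread deficiency))))
    in′ : inDegree double (R v) ≡ 0 + (inDegree D v + deficiency v)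
    in′ = trans (count-arcs (λ a → target a ≟ᶠ R v)) (cong₂ _+_
      (count-none _ (λ _ → L≢R) (Vec.allFin (m D)))
      (cong₂ _+_ (count-⇔ _ _ (λ _ → R-injective) (λ _ → cong R) (Vec.allFin (m D)))
        (trans (count-⇔ _ _ (λ _ → R-injective) (λ _ → cong R) (spread deficiency)) (count-spread deficiency v))))

  -- The hypothesis `degree≤k` makes the truncated subtraction in `deficiency` exact.
  double-regular : IsDegree double k
  double-regular w with splitAt (n D) w in eq
  ... | inj₁ v = trans (cong (degree double) (sym (splitAt⁻¹-↑ˡ eq))) (trans (degree-L v) (m+[n∸m]≡n (degree≤k v)))
  ... | inj₂ v = trans (cong (degree double) (sym (splitAt⁻¹-↑ʳ eq))) (trans (degree-R v) (m+[n∸m]≡n (degree≤k v)))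

  lookup-left : ∀ e → lookup arcs (e ↑ˡ _) ≡ left e
  lookup-left e = trans (lookup-++ˡ (Vec.map left (Vec.allFin (m D))) _ e)
    (trans (lookup-map e left (Vec.allFin (m D))) (cong left (Vec.lookup-allFin e)))

  lookup-right : ∀ e → lookup arcs (m D ↑ʳ (e ↑ˡ _)) ≡ right e
  lookup-right e = trans (lookup-++ʳ (Vec.map left (Vec.allFin (m D))) _ (e ↑ˡ _))
    (trans (lookup-++ˡ (Vec.map right (Vec.allFin (m D))) _ e)
      (trans (lookup-map e right (Vec.allFin (m D))) (cong right (Vec.lookup-allFin e))))

  -- The restrictions of `F` to the two copies are disjoint, and each is a feedback arc set of `D`
  -- by pullback. The part `F₃` between the copies can only add to the size.
  2fas≤∣FAS∣ : ∀ F → IsFeedbackArcSet double F → fas D + fas D ≤ ∣ F ∣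
  2fas≤∣FAS∣ F FAS
    with F₁ , F′ , refl ← Vec.splitAt (m D) F
    with F₂ , F₃ , refl ← Vec.splitAt (m D) F′ = begin
    fas D + fas D                  ≤⟨ +-mono-≤ (fas≤∣FAS∣ D F₁ FAS₁) (fas≤∣FAS∣ D F₂ FAS₂) ⟩
    ∣ F₁ ∣ + ∣ F₂ ∣                ≤⟨ +-monoʳ-≤ ∣ F₁ ∣ (m≤m+n ∣ F₂ ∣ ∣ F₃ ∣) ⟩
    ∣ F₁ ∣ + (∣ F₂ ∣ + ∣ F₃ ∣)     ≡⟨ cong (∣ F₁ ∣ ℕ.+_) (count-++ _ F₂ F₃) ⟨
    ∣ F₁ ∣ + ∣ F₂ ++ F₃ ∣          ≡⟨ count-++ _ F₁ (F₂ ++ F₃) ⟨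
    ∣ F₁ ++ (F₂ ++ F₃) ∣           ∎
    where
    open ≤-Reasoning
    FAS₁ : IsFeedbackArcSet D F₁
    FAS₁ = FAS-pullback D double (_↑ˡ _) L L-injective
      (cong source ∘ lookup-left) (cong target ∘ lookup-left)
      (λ {e} p → lookup⇒[]= e F₁ (trans (sym (lookup-++ˡ F₁ _ e)) ([]=⇒lookup p))) FAS
    FAS₂ : IsFeedbackArcSet D F₂
    FAS₂ = FAS-pullback D double (λ e → m D ↑ʳ (e ↑ˡ _)) R R-injective
      (cong source ∘ lookup-right) (cong target ∘ lookup-right)
      (λ {e} p → lookup⇒[]= e F₂ (trans (sym (lookup-++ˡ F₂ F₃ e))
        (trans (sym (lookup-++ʳ F₁ (F₂ ++ F₃) (e ↑ˡ _))) ([]=⇒lookup p)))) FAS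

  2fas≤fas-double : fas D + fas D ≤ fas double
  2fas≤fas-double = 2fas≤∣FAS∣ _ (minimum-isFeedbackArcSet double)

-- Rational bounds on ratios and their infima.

fromℕ-toℚᵘ : ∀ k → ℚ.toℚᵘ (fromℕ k) ℚᵘ.≃ (+ k ℚᵘ./ 1)
fromℕ-toℚᵘ k = ℚ.toℚᵘ-fromℚᵘ (+ k ℚᵘ./ 1)

-- Values of `fromℕ` are normalised fractions; over the unnormalised rationals the comparison
-- becomes one of integer numerators.
fromℕ-mono : ∀ {a b} → a ≤ b → fromℕ a ℚ.≤ fromℕ b
fromℕ-mono {a} {b} a≤b = ℚ.toℚᵘ-cancel-≤ (begin
  ℚ.toℚᵘ (fromℕ a) ≃⟨ fromℕ-toℚᵘ a ⟩
  + a ℚᵘ./ 1       ≤⟨ ℚᵘ.*≤* (ℤ.*-monoʳ-≤-nonNeg (+ 1) (ℤ.+≤+ a≤b)) ⟩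
  + b ℚᵘ./ 1       ≃⟨ fromℕ-toℚᵘ b ⟨
  ℚ.toℚᵘ (fromℕ b) ∎)
  where open ℚᵘ.≤-Reasoning

fromℕ-* : ∀ a b → fromℕ (a * b) ≡ fromℕ a ℚ.* fromℕ b
fromℕ-* a b = ℚ.toℚᵘ-injective (begin
  ℚ.toℚᵘ (fromℕ (a * b))                    ≈⟨ fromℕ-toℚᵘ (a * b) ⟩
  + (a * b) ℚᵘ./ 1                          ≈⟨ ℚᵘ.*≡* (cong (ℤ._* + 1) (ℤ.pos-* a b)) ⟩
  (+ a ℚᵘ./ 1) ℚᵘ.* (+ b ℚᵘ./ 1)            ≈⟨ ℚᵘ.*-cong (fromℕ-toℚᵘ a) (fromℕ-toℚᵘ b) ⟨
  ℚ.toℚᵘ (fromℕ a) ℚᵘ.* ℚ.toℚᵘ (fromℕ b)    ≈⟨ ℚ.toℚᵘ-homo-* (fromℕ a) (fromℕ b) ⟨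
  ℚ.toℚᵘ (fromℕ a ℚ.* fromℕ b)              ∎)
  where open Relation.Binary.Reasoning.Setoid ℚᵘ.≃-setoid

-- Rational bounds suffice to describe the upper cut of the infimum; the real
-- bounds live in ℝ : Set₁ and cannot be quantified over in a cut.
module Infimum (P : OrientedMultigraph → Set) (size : OrientedMultigraph → ℕ) where

  RationalBound : ℚ → Set
  RationalBound p = ∀ D → P D → fromℕ (fas D) ℚ.≤ fromℕ (size D) ℚ.* p

  Bounds : Pred ℝ 0ℓ
  Bounds c = ∀ D → P D → fromℚ (fromℕ (fas D)) ≤ᴿ size D · c

  -- If `size D` times `p` were below `fas D`, then `fas D` itself would lie in the upper cut of
  -- `size D · c`, and the bound would give `fas D` below itself.
  upper⇒rational : ∀ {c p} → Bounds c → Upper c p → RationalBound p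
  upper⇒rational bound cp D PD =
    ℚ.≮⇒≥ λ sp<fas → ℚ.<-irrefl refl (bound D PD (_ , cp , sp<fas))

  rational⇒bound : ∀ {p} → RationalBound p → Bounds (fromℚ p)
  rational⇒bound bound D PD (r , p<r , sr<q) = ℚ.≤-<-trans
    (ℚ.≤-trans (bound D PD)
      (ℚ.*-monoˡ-≤-nonNeg (fromℕ (size D)) {{ℚ.normalize-nonNeg (size D) 1}} (ℚ.<⇒≤ p<r)))
    sr<q

  -- The bound `u` makes the cut inhabited and `b` bounds it below, as a real requires.
  module _ {u b : ℚ} (u-bound : RationalBound u) (b-lower : ∀ {p} → RationalBound p → b ℚ.≤ p) where

    infimum : ℝ
    infimum .Upper q = ∃[ p ] (p ℚ.< q × RationalBound p)
    infimum .inhab with q , u<q ← inhab (fromℚ u) = q , u , u<q , u-bound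
    infimum .bounded = b , λ (p , p<q , bound) → ℚ.≤-trans (b-lower bound) (ℚ.<⇒≤ p<q)
    infimum .upward r<q (p , p<r , bound) = p , ℚ.<-trans p<r r<q , bound
    infimum .rounded (p , p<q , bound) with r , p<r , r<q ← ℚ.<-dense p<q = r , r<q , p , p<r , bound

    isInfimum : IsInfimum Bounds infimum
    isInfimum = lower , greatest
      where
      lower : ∀ c → Bounds c → infimum ≤ᴿ c
      -- Roundedness of `c` supplies the strict gap `p < q` that the cut of `infimum` demands.
      lower c bound cq with p , p<q , cp ← rounded c cq = p , p<q , upper⇒rational {c} bound cp

      greatest : ∀ y → (∀ c → Bounds c → y ≤ᴿ c) → y ≤ᴿ infimum
      greatest y y≤ (p , p<q , bound) = y≤ (fromℚ p) (rational⇒bound bound) p<q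

    lower≤infimum : fromℚ b ≤ᴿ infimum
    lower≤infimum (p , p<q , bound) = ℚ.≤-<-trans (b-lower bound) p<q

  rational-bound : ∀ c → (∀ D → P D → fas D ≤ size D * c) → RationalBound (fromℕ c)
  rational-bound c h D PD = subst (fromℕ (fas D) ℚ.≤_) (fromℕ-* (size D) c) (fromℕ-mono (h D PD))

  -- One digraph forces every bound up to its own ratio. The ratio `b` enters through a product,
  -- which evaluation can check for concrete numbers.
  witness≤bound : ∀ D → P D → ∀ {j b p} → j ≤ fas D → fromℕ (size D) ℚ.* b ≡ fromℕ j →
                  .{{ℚ.Positive (fromℕ (size D))}} → RationalBound p → b ℚ.≤ p
  witness≤bound D PD j≤fas sb≡j bound = ℚ.*-cancelˡ-≤-pos (fromℕ (size D))
    (ℚ.≤-trans (ℚ.≤-trans (ℚ.≤-reflexive sb≡j) (fromℕ-mono j≤fas)) (bound D PD))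

-- The three constants for degree 6.

module ArcRatio≤    = Infimum (λ D → Δ D ≤ 6) m
module VertexRatio≤ = Infimum (λ D → Δ D ≤ 6) n
module VertexRatio  = Infimum (λ D → IsDegree D 6) n

-- The bound is applied to the degree-6 double of `D`; the factor 2 in the vertex number cancels
-- against the factor 2 in `fas`.
bound⇒bound≤ : ∀ {p} → VertexRatio.RationalBound p → VertexRatio≤.RationalBound p
bound⇒bound≤ {p} bound D Δ≤6 = ℚ.*-cancelˡ-≤-pos (fromℕ 2) (begin
  fromℕ 2 ℚ.* fromℕ (fas D)          ≡⟨ fromℕ-* 2 (fas D) ⟨
  fromℕ (2 * fas D)                  ≡⟨ cong (λ x → fromℕ (fas D + x)) (+-identityʳ (fas D)) ⟩
  fromℕ (fas D + fas D)              ≤⟨ fromℕ-mono 2fas≤fas-double ⟩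
  fromℕ (fas double)                 ≤⟨ bound double double-regular ⟩
  fromℕ (n D + n D) ℚ.* p            ≡⟨ cong (λ x → fromℕ (n D + x) ℚ.* p) (+-identityʳ (n D)) ⟨
  fromℕ (2 * n D) ℚ.* p              ≡⟨ cong (ℚ._* p) (fromℕ-* 2 (n D)) ⟩
  fromℕ 2 ℚ.* fromℕ (n D) ℚ.* p      ≡⟨ ℚ.*-assoc (fromℕ 2) (fromℕ (n D)) p ⟩
  fromℕ 2 ℚ.* (fromℕ (n D) ℚ.* p)    ∎)
  where
  open ℚ.≤-Reasoning
  open Doubling D 6 (λ v → ≤-trans (degree≤Δ D v) Δ≤6)
    using (double; double-regular; 2fas≤fas-double)

bound≤⇒bound : ∀ {p} → VertexRatio≤.RationalBound p → VertexRatio.RationalBound p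
bound≤⇒bound bound D regular = bound D (regular⇒Δ≤ D regular)

proposition11 :
  (∃[ D ] (IsOrientedGraph D × IsDegree D 6 × 25 * m D ≤ 72 * fas D))
  × (∃[ c′≤6 ] ∃[ c″≤6 ] ∃[ c″₆ ]
       ( IsInfimum (ArcBounds≤ 6) c′≤6
       × IsInfimum (VertexBounds≤ 6) c″≤6
       × IsInfimum (VertexBounds 6) c″₆
       × fromℚ (+ 25 / 72) ≤ᴿ c′≤6
       × c″≤6 ≈ᴿ c″₆
       × fromℚ (+ 75 / 72) ≤ᴿ c″₆ ))
proposition11 =
  -- As `m D₂₄` is 72, both `25 * m D₂₄` and `72 * 25` evaluate to 1800.
  (D₂₄ , D₂₄-simple , D₂₄-regular , *-monoʳ-≤ 72 25≤fas) ,
  ( ArcRatio≤.infimum arc-upper arc-lower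
  , VertexRatio≤.infimum vertex-upper vertex≤-lower
  , VertexRatio.infimum (bound≤⇒bound vertex-upper) vertex-lower
  , ArcRatio≤.isInfimum arc-upper arc-lower
  , VertexRatio≤.isInfimum vertex-upper vertex≤-lower
  , VertexRatio.isInfimum (bound≤⇒bound vertex-upper) vertex-lower
  , ArcRatio≤.lower≤infimum arc-upper arc-lower
  -- Each cut consists of the rationals above some rational bound, and the two vertex ratios have
  -- the same rational bounds.
  , ( (λ (p , p<q , bound) → p , p<q , bound⇒bound≤ bound)
    , (λ (p , p<q , bound) → p , p<q , bound≤⇒bound bound))
  , VertexRatio.lower≤infimum (bound≤⇒bound vertex-upper) vertex-lower )
  where
  25≤fas : 25 ≤ fas D₂₄
  25≤fas = D₂₄-bound (minimum-isFeedbackArcSet D₂₄)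

  -- The values 1 here and 6 in `vertex-upper` are trivial bounds, from `fas ≤ m` and `m ≤ 6 n`;
  -- they serve to inhabit the cuts.
  arc-upper : ArcRatio≤.RationalBound (fromℕ 1)
  arc-upper = ArcRatio≤.rational-bound 1 λ D _ →
    subst (fas D ≤_) (sym (*-identityʳ (m D))) (fas≤m D)

  arc-lower : ∀ {p} → ArcRatio≤.RationalBound p → + 25 / 72 ℚ.≤ p
  arc-lower = ArcRatio≤.witness≤bound D₂₄ (regular⇒Δ≤ D₂₄ D₂₄-regular) 25≤fas refl

  vertex-upper : VertexRatio≤.RationalBound (fromℕ 6)
  vertex-upper = VertexRatio≤.rational-bound 6 λ D Δ≤6 →
    ≤-trans (fas≤m D) (≤-trans (m≤n*Δ D) (*-monoʳ-≤ (n D) Δ≤6))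

  vertex-lower : ∀ {p} → VertexRatio.RationalBound p → + 75 / 72 ℚ.≤ p
  -- Here `refl` checks that 24 times 75/72 is 25.
  vertex-lower = VertexRatio.witness≤bound D₂₄ D₂₄-regular 25≤fas refl

  vertex≤-lower : ∀ {p} → VertexRatio≤.RationalBound p → + 75 / 72 ℚ.≤ p
  vertex≤-lower = vertex-lower ∘ bound≤⇒bound
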